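{- For any integer $\gamma \geq 0$, as a set-operad, the underlying set of $\mathsf{Dias}_\gamma$ is the set of all words on the alphabet $\{0, 1, \dots, \gamma\}$ containing exactly one occurrence of $0$.
   Context: Write $[\gamma] = \{1, \dots, \gamma\}$. Operads are nonsymmetric, described by partial compositions $\circ_i$ and a unit; a set-operad is a nonsymmetric operad in sets. For a monoid $(\mathcal{M}, \bullet, 1)$, $\mathsf{T}\mathcal{M}$ is the set-operad whose elements of arity $n \geq 1$ are the words $u_1 \dots u_n$ of length $n$ on $\mathcal{M}$, with partial compositions $u \circ_i v := u_1 \dots u_{i-1}\,(u_i \bullet v_1) \dots (u_i \bullet v_m)\, u_{i+1} \dots u_n$ for $u$ of length $n$, $v$ of length $m$, $1 \le i \le n$, and with unit the one-letter word $1$. Let $\mathcal{M}_\gamma$ be the monoid on $\{0\} \cup [\gamma]$ with product $\max$ (whose unit is $0$). $\mathsf{Dias}_\gamma$ is the suboperad of $\mathsf{T}\mathcal{M}_\gamma$ generated by the set of two-letter words $\{0a, a0 : a \in [\gamma]\}$, i.e. the smallest set of words containing these words and the unit word $0$ and closed under all partial compositions. -}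

module Defs where

open import Algebra.Structures using (IsMonoid)
import Algebra.Construct.NaturalChoice.Max as Max
open import Data.Fin.Base using (Fin; zero; suc)
open import Data.Fin.Properties using (≤-totalOrder; _≟_)
import Data.List.Base as List
open import Data.List.NonEmpty.Base
  using (List⁺; _∷_; _∷⁺_; [_]; _⁺++_; length; map; toList)
open import Data.Nat.Base using (ℕ; suc; z≤n)
open import Level using (Level; 0ℓ; _⊔_)
open import Relation.Binary.PropositionalEquality.Core using (_≡_)
open import Relation.Unary using (Pred; _∈_)

-- The set-operad T𝓜. The arity of a word is its length, and arities are at
-- least 1, whence List⁺; input positions are counted from 0.
module T {a : Level} {M : Set a} {_∙_ : M → M → M} {ε : M}
         (isMonoid : IsMonoid _≡_ _∙_ ε) where

  infixl 7 _∘[_]_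

  unit : List⁺ M
  unit = [ ε ]

  _∘[_]_ : (u : List⁺ M) → Fin (length u) → List⁺ M → List⁺ M
  (x ∷ xs)            ∘[ zero  ] v = map (x ∙_) v ⁺++ xs
  (x ∷ (y List.∷ ys)) ∘[ suc i ] v = x ∷⁺ ((y ∷ ys) ∘[ i ] v)

  -- The suboperad generated by G.
  data ⟨_⟩ {ℓ : Level} (G : Pred (List⁺ M) ℓ) : Pred (List⁺ M) (a ⊔ ℓ) where
    generator : ∀ {u} → u ∈ G → u ∈ ⟨ G ⟩
    identity  : unit ∈ ⟨ G ⟩
    compose   : ∀ {u v} → u ∈ ⟨ G ⟩ → (i : Fin (length u)) → v ∈ ⟨ G ⟩ →
                (u ∘[ i ] v) ∈ ⟨ G ⟩

-- The monoid 𝓜_γ, with Fin (suc γ) as {0} ∪ [γ]; the elements of [γ] are the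
-- suc a with a : Fin γ.
max : (γ : ℕ) → Fin (suc γ) → Fin (suc γ) → Fin (suc γ)
max γ = Max._⊔_ (≤-totalOrder (suc γ))

max-isMonoid : (γ : ℕ) → IsMonoid _≡_ (max γ) zero
max-isMonoid γ = Max.⊔-isMonoid (≤-totalOrder (suc γ)) (λ _ → z≤n)

data DiasGenerator (γ : ℕ) : Pred (List⁺ (Fin (suc γ))) 0ℓ where
  0a : (a : Fin γ) → (zero ∷ List.[ suc a ]) ∈ DiasGenerator γ
  a0 : (a : Fin γ) → (suc a ∷ List.[ zero ]) ∈ DiasGenerator γ

Dias : (γ : ℕ) → Pred (List⁺ (Fin (suc γ))) 0ℓ
Dias γ = T.⟨_⟩ (max-isMonoid γ) (DiasGenerator γ)

ExactlyOneZero : (γ : ℕ) → Pred (List⁺ (Fin (suc γ))) 0ℓ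
ExactlyOneZero γ w = List.length (List.filter (_≟ zero) (toList w)) ≡ 1

{-# OPTIONS --safe #-}
-- Composing with a word having a single zero preserves the number of zeros: the
-- grafted copy x • v has one zero if x = 0 and none otherwise. Conversely,
-- 0 y ys = (0 ys) ∘ (0y) at the first position and a w = (a0) ∘ w at the second,
-- so the nonzero letters after the zero, then those before it, are added one by one.
module Submission where

open import Defs
open import Algebra.Structures using (IsMonoid)
import Algebra.Construct.NaturalChoice.Max as Max
open import Data.Fin.Base using (Fin; zero; suc; _≤_)
open import Data.Fin.Properties using (≤-totalOrder; _≟_)
open import Data.List.Base as List using (List; []; _∷_; _++_; filter)
open import Data.List.NonEmpty.Base using (_∷_; _∷⁺_; toList)
open import Data.List.Properties
  using (filter-++; filter-none; length-++; map-id; map-cong; ++-identityʳ)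
import Data.List.Relation.Unary.All as All
import Data.List.Relation.Unary.All.Properties as All
open import Data.Nat.Base using (ℕ; _+_)
open import Data.Nat.Properties using (suc-injective)
open import Data.Product.Base using (_,_)
open import Relation.Binary.PropositionalEquality
  using (_≡_; _≢_; refl; trans; cong; cong₂; subst; module ≡-Reasoning)
open import Relation.Unary using (_≐_; _∈_)

module _ {γ : ℕ} where

  open T (max-isMonoid γ)
  open IsMonoid (max-isMonoid γ) using (identityˡ)
  open Max (≤-totalOrder (ℕ.suc γ)) using (x≤x⊔y)

  private
    Word = List (Fin (ℕ.suc γ))

  zeros : Word → ℕ
  zeros w = List.length (filter (_≟ zero) w)

  zeros-++ : (v w : Word) → zeros (v ++ w) ≡ zeros v + zeros w
  zeros-++ v w = trans (cong List.length (filter-++ (_≟ zero) v w))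
                       (length-++ (filter (_≟ zero) v))

  map-max-zero : (w : Word) → List.map (max γ zero) w ≡ w
  map-max-zero w = trans (map-cong identityˡ w) (map-id w)

  max-suc≢zero : (a : Fin γ) (y : Fin (ℕ.suc γ)) → max γ (suc a) y ≢ zero
  max-suc≢zero a y eq
    -- The maximum bounds `suc a` from above, so `eq` would give `suc a ≤ zero`, an empty type.
    with () ← subst (suc a ≤_) eq (x≤x⊔y (suc a) y)

  zeros-map-max : (x : Fin (ℕ.suc γ)) (v : Word) → zeros v ≡ 1 →
                  zeros (List.map (max γ x) v) ≡ zeros List.[ x ]
  zeros-map-max zero    v v₁ = trans (cong zeros (map-max-zero v)) v₁
  zeros-map-max (suc a) v _  = cong List.length
    (filter-none (_≟ zero) (All.map⁺ (All.universal (max-suc≢zero a) v)))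

  -- Only the letter at position `i` changes, into a block with the same count. The count of `u` is
  -- left arbitrary because the recursion drops letters of `u`, possibly its zero.
  zeros-∘ : ∀ u i {v} → zeros (toList v) ≡ 1 →
            zeros (toList (u ∘[ i ] v)) ≡ zeros (toList u)
  zeros-∘ (x ∷ xs) zero {v@(_ ∷ _)} v₁ = begin
    zeros (List.map (max γ x) (toList v) ++ xs)        ≡⟨ zeros-++ (List.map (max γ x) (toList v)) xs ⟩
    zeros (List.map (max γ x) (toList v)) + zeros xs   ≡⟨ cong (_+ zeros xs) (zeros-map-max x (toList v) v₁) ⟩
    zeros List.[ x ] + zeros xs                        ≡⟨ zeros-++ List.[ x ] xs ⟨
    zeros (x ∷ xs)                                     ∎
    where open ≡-Reasoning
  zeros-∘ (x ∷ y ∷ ys) (suc i) {v} v₁ = begin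
    zeros (x ∷ toList w)                     ≡⟨ zeros-++ List.[ x ] (toList w) ⟩
    zeros List.[ x ] + zeros (toList w)      ≡⟨ cong (zeros List.[ x ] +_) (zeros-∘ (y ∷ ys) i v₁) ⟩
    zeros List.[ x ] + zeros (y ∷ ys)        ≡⟨ zeros-++ List.[ x ] (y ∷ ys) ⟨
    zeros (x ∷ y ∷ ys)                       ∎
    where
    open ≡-Reasoning
    w = (y ∷ ys) ∘[ i ] v

  Dias⇒ExactlyOneZero : ∀ {w} → w ∈ Dias γ → w ∈ ExactlyOneZero γ
  Dias⇒ExactlyOneZero (generator (0a _)) = refl
  Dias⇒ExactlyOneZero (generator (a0 _)) = refl
  Dias⇒ExactlyOneZero identity           = refl
  Dias⇒ExactlyOneZero (compose {u} u∈ i v∈) =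
    trans (zeros-∘ u i (Dias⇒ExactlyOneZero v∈)) (Dias⇒ExactlyOneZero u∈)

  suc∷⁺-Dias : ∀ a {w} → w ∈ Dias γ → (suc a ∷⁺ w) ∈ Dias γ
  suc∷⁺-Dias a {x ∷ xs} w∈ =
    -- The raw composite has `max γ zero` on each letter of `w` and a trailing `++ []`; the
    -- transport removes both.
    subst (_∈ Dias γ)
      (cong₂ (λ y ys → suc a ∷⁺ (y ∷ ys)) (identityˡ x)
        (trans (++-identityʳ _) (map-max-zero xs)))
      (compose (generator (a0 a)) (suc zero) w∈)

  -- Each new letter enters directly after the zero and pushes the others right, so `xs` is built
  -- from its last letter backwards.
  zero∷-Dias : (xs : Word) → zeros xs ≡ 0 → (zero ∷ xs) ∈ Dias γ
  zero∷-Dias []           _  = identity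
  -- A leading `zero` in the list would make the count positive, against `≡ 0`.
  zero∷-Dias (suc a ∷ xs) eq =
    -- Here `max γ zero` computes on `zero` and `suc a`, so no transport is required.
    compose (zero∷-Dias xs eq) zero (generator (0a a))

  ExactlyOneZero⇒Dias : ∀ x xs → (x ∷ xs) ∈ ExactlyOneZero γ → (x ∷ xs) ∈ Dias γ
  ExactlyOneZero⇒Dias zero    xs       eq = zero∷-Dias xs (suc-injective eq)
  -- The word `suc a` alone has no zero, so a letter `y` follows; `suc a` adds nothing to the count,
  -- so `eq` passes unchanged to the tail.
  ExactlyOneZero⇒Dias (suc a) (y ∷ ys) eq = suc∷⁺-Dias a (ExactlyOneZero⇒Dias y ys eq)

proposition2p1p1 : (γ : ℕ) → Dias γ ≐ ExactlyOneZero γ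
proposition2p1p1 γ = Dias⇒ExactlyOneZero , λ { {x ∷ xs} → ExactlyOneZero⇒Dias x xs }
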